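{- Let $G$ be a plane graph and let $v_1v_2\cdots v_{2n-1}$ be a path on the boundary of its unbounded face, such that $v_2,v_4,\dots,v_{2n-2}$ have degree two in $G$. Then there is a bijection between the set of spanning trees of $G$ rooted at $v_{2n-1}$ which contain the oriented edges $(v_2,v_3),(v_4,v_5),\dots,(v_{2n-2},v_{2n-1})$ and the set of spanning trees of $G$ rooted at $v_1$ which contain the oriented edges $(v_2,v_1),(v_4,v_3),\dots,(v_{2n-2},v_{2n-3})$.
   Context: Graphs have no loops and no multiple edges. A spanning tree of $G$ rooted at a vertex $v$ is a spanning tree $T$ in which every edge is oriented toward $v$ (i.e., along the unique path in $T$ from the edge to $v$); so each vertex other than $v$ has exactly one outgoing edge. $T$ contains the oriented edge $(a,b)$ if $\{a,b\}$ is an edge of $T$ and it is oriented from $a$ to $b$. -}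

module Defs where

open import Data.Nat using (ℕ; zero; suc; _+_; _*_; _≤ᵇ_)
open import Data.Bool using (Bool; true; false; if_then_else_; _∧_)
open import Data.Fin using (Fin; toℕ; _≟_)
open import Data.List using (List; []; _∷_; _++_; allFin; upTo; map; concatMap)
open import Data.Bool.ListAction using (all; any)
open import Data.Product using (Σ; ∃; _×_; _,_; proj₁)
open import Data.Sum using (_⊎_)
open import Relation.Nullary using (¬_)
open import Relation.Nullary.Decidable using (⌊_⌋)
open import Relation.Binary using (Setoid)
open import Relation.Binary.PropositionalEquality using (_≡_; _≢_; refl; sym; trans)

iter : {A : Set} → (A → A) → ℕ → A → A
iter f zero    x = x
iter f (suc k) x = f (iter f k x)

countᵇ : {A : Set} → (A → Bool) → List A → ℕ
countᵇ p []       = 0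
countᵇ p (x ∷ xs) = (if p x then 1 else 0) + countᵇ p xs

-- x is the smallest element (w.r.t. toℕ) of its orbit under the
-- permutation f of Fin d (an orbit has at most d elements, so the
-- iterates f^k x for k < d cover the orbit).
isOrbitMin : {d : ℕ} → (Fin d → Fin d) → Fin d → Bool
isOrbitMin {d} f x = all (λ k → toℕ x ≤ᵇ toℕ (iter f k x)) (upTo d)

-- Combinatorial maps (rotation systems).
-- A graph with vertex set Fin V, each edge {u,w} represented by two
-- darts (half-edges) x, rev x with tail x = u, tail (rev x) = w.
-- rot x is the next dart around tail x in the (counterclockwise)
-- cyclic order given by the embedding.

reachList : {d : ℕ} → (Fin d → Fin d) → (Fin d → Fin d) → ℕ → Fin d → List (Fin d)
reachList rot rev zero    x = x ∷ []
reachList rot rev (suc k) x =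
  let l = reachList rot rev k x in l ++ concatMap (λ y → rot y ∷ rev y ∷ []) l

inComp : {d : ℕ} → (Fin d → Fin d) → (Fin d → Fin d) → Fin d → Fin d → Bool
inComp {d} rot rev x y = any (λ z → ⌊ z ≟ y ⌋) (reachList rot rev d x)

facePerm : {d : ℕ} → (Fin d → Fin d) → (Fin d → Fin d) → Fin d → Fin d
facePerm rot rev x = rot (rev x)

compDarts compVerts compFaces : {d : ℕ} → (Fin d → Fin d) → (Fin d → Fin d) → Fin d → ℕ
compDarts {d} rot rev x = countᵇ (inComp rot rev x) (allFin d)
compVerts {d} rot rev x =
  countᵇ (λ y → inComp rot rev x y ∧ isOrbitMin rot y) (allFin d)
compFaces {d} rot rev x =
  countᵇ (λ y → inComp rot rev x y ∧ isOrbitMin (facePerm rot rev) y) (allFin d)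

-- A plane graph, given combinatorially by a simple graph together with a
-- rotation system in which every connected component has genus 0
-- (Euler's formula V - E + F = 2 per component, with E = darts/2).
record PlaneGraph : Set where
  field
    V      : ℕ
    d      : ℕ
    tail   : Fin d → Fin V
    rev    : Fin d → Fin d
    rot    : Fin d → Fin d
    rev-invol   : ∀ x → rev (rev x) ≡ x
    no-loops    : ∀ x → tail (rev x) ≢ tail x
    no-multi    : ∀ x y → tail x ≡ tail y → tail (rev x) ≡ tail (rev y) → x ≡ y
    rot-tail    : ∀ x → tail (rot x) ≡ tail x
    rot-inj     : ∀ x y → rot x ≡ rot y → x ≡ y
    rot-cyclic  : ∀ x y → tail x ≡ tail y → ∃ λ k → iter rot k x ≡ y
    genus-zero  : ∀ x → 2 * compVerts rot rev x + 2 * compFaces rot rev x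
                          ≡ compDarts rot rev x + 4

  head : Fin d → Fin V
  head x = tail (rev x)

open PlaneGraph public

Adj : (G : PlaneGraph) → Fin (V G) → Fin (V G) → Set
Adj G u w = ∃ λ x → tail G x ≡ u × head G x ≡ w

degree : (G : PlaneGraph) → Fin (V G) → ℕ
degree G u = countᵇ (λ x → ⌊ tail G x ≟ u ⌋) (allFin (d G))

OnFace : (G : PlaneGraph) → Fin (d G) → Fin (d G) → Set
OnFace G f x = ∃ λ k → iter (facePerm (rot G) (rev G)) k f ≡ x

BoundaryEdge : (G : PlaneGraph) → Fin (d G) → Fin (V G) → Fin (V G) → Set
BoundaryEdge G f u w =
  ∃ λ x → tail G x ≡ u × head G x ≡ w × (OnFace G f x ⊎ OnFace G f (rev G x))

-- Spanning trees rooted at r, with all edges oriented towards r.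
-- Such a tree is given by its out-edges: every vertex u ≠ r has exactly
-- one outgoing edge (u , par u); by convention par r = r.
-- The edges {u, par u} (u ≠ r) form a spanning tree oriented toward r
-- exactly when following par from any vertex eventually reaches r.
IsRootedSpanningTree : (G : PlaneGraph) → Fin (V G) → (Fin (V G) → Fin (V G)) → Set
IsRootedSpanningTree G r par =
  par r ≡ r
  × (∀ u → u ≢ r → Adj G u (par u))
  × (∀ u → ∃ λ k → iter par k u ≡ r)

ContainsOriented : (G : PlaneGraph) → Fin (V G) → (Fin (V G) → Fin (V G))
                 → Fin (V G) → Fin (V G) → Set
ContainsOriented G r par a b = a ≢ r × par a ≡ b

TreeSetoid : (G : PlaneGraph) → (r : Fin (V G))
           → ((Fin (V G) → Fin (V G)) → Set) → Setoid _ _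
TreeSetoid G r P = record
  { Carrier       = Σ (Fin (V G) → Fin (V G)) (λ par → IsRootedSpanningTree G r par × P par)
  ; _≈_           = λ s t → ∀ u → proj₁ s u ≡ proj₁ t u
  ; isEquivalence = record
      { refl  = λ u → refl
      ; sym   = λ p u → sym (p u)
      ; trans = λ p q u → trans (p u) (q u)
      }
  }

{-# OPTIONS --safe #-}
module Submission where

-- The statement holds for every finite graph.  Write the path as w₀ e₀ w₁ e₁ … eₘ₋₁ wₘ with the eᵢ
-- of degree two, and let the root wₘ of a tree point to w₀.  A configuration is a function f that
-- sends wₘ to w₀ and eᵢ to wᵢ₊₁, follows edges elsewhere, and has the root on a cycle, together with
-- a set of marked cycles of f avoiding the root; its sign is the parity of the number of marks.
-- Toggling the mark of one canonically chosen cycle is a sign-reversing involution whose fixed points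
-- are the trees.  Reversing f along the root cycle and the marked cycles, and off them replacing
-- eᵢ ↦ wᵢ₊₁ by eᵢ ↦ wᵢ and wᵢ ↦ eᵢ by wᵢ ↦ eᵢ₋₁, is a sign-preserving bijection to the configurations
-- of the opposite path, so the Garsia–Milne involution principle matches the trees on the two sides.
-- (In terms of determinants: two reduced Laplacians are transposes of each other.)

open import Defs
open import Data.Bool using (Bool; true; false; not; _xor_)
import Data.Bool.Properties as Bool
open import Data.Nat using (ℕ; zero; suc; _*_; _+_; _≤_; _<_; _^_; z≤n; s≤s)
import Data.Nat as ℕ using (pred)
import Data.Nat.Properties as ℕ
open import Data.Nat.Induction using (<-rec)
open import Data.Fin using (Fin; zero; suc; toℕ; fromℕ<; _≟_; combine; funToFin; finToFun)
open import Data.Fin.Properties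
  using (any?; all?; pigeonhole; toℕ<n; toℕ-fromℕ<; combine-injective; finToFun-funToFin)
open import Data.List using (List; []; _∷_; length; filterᵇ; allFin)
open import Data.List.Membership.Propositional using (_∈_)
open import Data.List.Membership.Propositional.Properties using (∈-filter⁺; ∈-allFin)
open import Data.List.Relation.Unary.Any using (here; there)
open import Data.Product using (∃; ∃₂; _×_; _,_; proj₁; proj₂)
open import Data.Sum using (_⊎_; inj₁; inj₂)
open import Data.Vec using (Vec; []; _∷_; lookup; tabulate; replicate; _[_]%=_)
open import Data.Vec.Properties
  using (lookup∘tabulate; tabulate∘lookup; tabulate-cong; lookup-replicate; lookup∘updateAt′
        ; updateAt-updateAt; updateAt-id; updateAt-cong)
open import Function using (_∘_)
open import Function.Bundles using (Bijection)
open import Relation.Binary.PropositionalEquality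
open import Relation.Nullary
  using (¬_; Dec; yes; no; contradiction; map′; fromWitness; ¬?; _×-dec_; _⊎-dec_; _→-dec_)
open import Relation.Unary using (Decidable)
open ≡-Reasoning

-- Orbits

least : ∀ {n} {Q : Fin n → Set} → Decidable Q → ∀ {u} → Q u
      → ∃ λ w → Q w × (∀ v → Q v → toℕ w ≤ toℕ v)
least {suc n} Q? {u} q with Q? zero
... | yes q₀ = zero , q₀ , λ _ _ → z≤n
least {suc n} Q? {zero}  q | no ¬q₀ = contradiction q ¬q₀
least {suc n} Q? {suc u} q | no ¬q₀ with least (Q? ∘ suc) q
... | w , qw , min = suc w , qw , λ { zero q₀ → contradiction q₀ ¬q₀ ; (suc v) qv → s≤s (min v qv) }

Reach : {A : Set} → (A → A) → A → A → Set
Reach f u v = ∃ λ k → iter f k u ≡ v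

-- Starting from `f u` forces at least one step; the witness is one less than a period of `u`.
Cyclic : {A : Set} → (A → A) → A → Set
Cyclic f u = Reach f (f u) u

module _ {A : Set} (f : A → A) where

  iter-+ : ∀ a b x → iter f (a + b) x ≡ iter f a (iter f b x)
  iter-+ zero    b x = refl
  iter-+ (suc a) b x = cong f (iter-+ a b x)

  iter-comm : ∀ a b x → iter f a (iter f b x) ≡ iter f b (iter f a x)
  iter-comm a b x = begin
    iter f a (iter f b x) ≡⟨ iter-+ a b x ⟨
    iter f (a + b) x      ≡⟨ cong (λ k → iter f k x) (ℕ.+-comm a b) ⟩
    iter f (b + a) x      ≡⟨ iter-+ b a x ⟩
    iter f b (iter f a x) ∎

  iter-period : ∀ q {x} → iter f q x ≡ x → ∀ t → iter f (t * q) x ≡ x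
  iter-period q     p zero    = refl
  iter-period q {x} p (suc t) =
    trans (iter-+ q (t * q) x) (trans (cong (iter f q) (iter-period q p t)) p)

  period : ∀ {u} → Cyclic f u → ∃ λ l → iter f (suc l) u ≡ u
  period {u} (l , e) = l , trans (iter-comm 1 l u) e

  cyclic : ∀ {u} l → iter f (suc l) u ≡ u → Cyclic f u
  cyclic {u} l e = l , trans (iter-comm l 1 u) e

  reach-refl : ∀ {u} → Reach f u u
  reach-refl = 0 , refl

  reach-trans : ∀ {u v w} → Reach f u v → Reach f v w → Reach f u w
  reach-trans {u} (a , refl) (b , refl) = b + a , iter-+ b a u

  reach-step : ∀ {u v} → Reach f u v → Reach f u (f v)
  reach-step (k , e) = suc k , cong f e

  -- Of the `k * suc l` steps that bring `u` back to itself, the first `k` lead to `v`, so the other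
  -- `k * l` lead from `v` back to `u`.
  reach-sym : ∀ {u v} → Cyclic f u → Reach f u v → Reach f v u
  reach-sym {u} c (k , refl) with period c
  ... | l , e = k * l , (begin
    iter f (k * l) (iter f k u) ≡⟨ iter-+ (k * l) k u ⟨
    iter f (k * l + k) u        ≡⟨ cong (λ j → iter f j u) (trans (ℕ.+-comm (k * l) k) (sym (ℕ.*-suc k l))) ⟩
    iter f (k * suc l) u        ≡⟨ iter-period (suc l) e k ⟩
    u                           ∎)

  cyclic-reach : ∀ {u v} → Cyclic f u → Reach f u v → Cyclic f v
  cyclic-reach {u} c (k , refl) with period c
  ... | l , e = cyclic l (trans (iter-comm (suc l) k u) (cong (iter f k) e))

  -- The common successor `z` has the periods `suc i` and `suc j`. Both `x` and `y` lie on its orbit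
  -- one step short of the common period `suc i * suc j`.
  cyclic-injective : ∀ {x y} → Cyclic f x → Cyclic f y → f x ≡ f y → x ≡ y
  cyclic-injective {x} {y} (i , p) (j , q) eq = begin
    x                            ≡⟨ p ⟨
    iter f i z                   ≡⟨ cong (iter f i) (iter-period (suc i) fp j) ⟨
    iter f i (iter f (j * suc i) z) ≡⟨ iter-+ i (j * suc i) z ⟨
    iter f (i + j * suc i) z     ≡⟨ cong (λ k → iter f k z) arith ⟩
    iter f (j + i * suc j) z     ≡⟨ iter-+ j (i * suc j) z ⟩
    iter f j (iter f (i * suc j) z) ≡⟨ cong (iter f j) (iter-period (suc j) fq i) ⟩
    iter f j z                   ≡⟨ q′ ⟩
    y                            ∎
    where
    z = f x
    q′ : iter f j z ≡ y
    q′ = trans (cong (iter f j) eq) q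
    fp : iter f (suc i) z ≡ z
    fp = cong f p
    fq : iter f (suc j) z ≡ z
    fq = trans (cong f q′) (sym eq)
    arith : i + j * suc i ≡ j + i * suc j
    arith = begin
      i + j * suc i     ≡⟨ cong (i +_) (ℕ.*-suc j i) ⟩
      i + (j + j * i)   ≡⟨ ℕ.+-assoc i j (j * i) ⟨
      (i + j) + j * i   ≡⟨ cong₂ _+_ (ℕ.+-comm i j) (ℕ.*-comm j i) ⟩
      (j + i) + i * j   ≡⟨ ℕ.+-assoc j i (i * j) ⟩
      j + (i + i * j)   ≡⟨ cong (j +_) (ℕ.*-suc i j) ⟨
      j + i * suc j     ∎

module _ {n : ℕ} (f : Fin n → Fin n) where

  -- Pigeonhole on the first `suc n` iterates. The bound `suc l + i ≤ n` is what lets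
  -- `reach-bounded` shorten every walk of length at least `n`.
  collision : ∀ u → ∃₂ λ i l → suc l + i ≤ n × iter f (suc l + i) u ≡ iter f i u
  collision u with pigeonhole (ℕ.n<1+n n) (λ k → iter f (toℕ k) u)
  ... | i , j , i<j , e with ℕ.m≤n⇒∃[o]m+o≡n i<j
  ... | l , refl′ = toℕ i , l ,
    subst (_≤ n) (sym len) (ℕ.≤-pred (toℕ<n j)) ,
    trans (cong (λ k → iter f k u) len) (sym e)
    where
    len : suc l + toℕ i ≡ toℕ j
    len = trans (cong suc (ℕ.+-comm l (toℕ i))) refl′

  reach-cyclic : ∀ u → ∃ λ v → Reach f u v × Cyclic f v
  reach-cyclic u with collision u
  ... | i , l , _ , e = iter f i u , (i , refl) , cyclic f l (trans (sym (iter-+ f (suc l) i u)) e)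

  -- Strong induction on the length: a walk of length at least `n` runs through the loop found by
  -- `collision`, and cutting out `suc l` steps keeps its end. The bound makes reachability
  -- decidable.
  reach-bounded : ∀ {u v} → Reach f u v → ∃ λ (k : Fin n) → iter f (toℕ k) u ≡ v
  reach-bounded {u} (k , e) = <-rec Bounded go k e
    where
    Bounded : ℕ → Set
    Bounded k = ∀ {v} → iter f k u ≡ v → ∃ λ (i : Fin n) → iter f (toℕ i) u ≡ v
    go : ∀ k → (∀ {j} → j < k → Bounded j) → Bounded k
    go k rec e with suc k ℕ.≤? n
    ... | yes k<n = fromℕ< k<n , trans (cong (λ j → iter f j u) (toℕ-fromℕ< k<n)) e
    ... | no  k≮n with collision u
    ... | i , l , b , c with ℕ.m≤n⇒∃[o]m+o≡n (ℕ.≤-trans b (ℕ.≮⇒≥ k≮n))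
    ... | t , refl = rec smaller (begin
      iter f (i + t) u                ≡⟨ cong (λ j → iter f j u) (ℕ.+-comm i t) ⟩
      iter f (t + i) u                ≡⟨ iter-+ f t i u ⟩
      iter f t (iter f i u)           ≡⟨ cong (iter f t) c ⟨
      iter f t (iter f (suc l + i) u) ≡⟨ iter-+ f t (suc l + i) u ⟨
      iter f (t + (suc l + i)) u      ≡⟨ cong (λ j → iter f j u) (ℕ.+-comm t (suc l + i)) ⟩
      iter f (suc l + i + t) u        ≡⟨ e ⟩
      _                               ∎)
      where
      smaller : i + t < suc l + i + t
      smaller = s≤s (ℕ.+-monoˡ-≤ t (ℕ.m≤n+m i l))

  reach? : ∀ u v → Dec (Reach f u v)
  reach? u v = map′ (λ (k , e) → toℕ k , e) reach-bounded (any? λ k → iter f (toℕ k) u ≟ v)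

-- Chains of a partial injection and the involution principle

-- A partial injection R on a finite type: the R-chains pair up the points without a predecessor
-- with the points without a successor.
module Chains {X : Set} {N : ℕ} (code : X → Fin N) (code-injective : ∀ {x y} → code x ≡ code y → x ≡ y) where

  -- Steps are appended at the end, so arguments that go back along a chain peel off the last step
  -- by matching; going forward takes `head-step`.
  data Steps (R : X → X → Set) : ℕ → X → X → Set where
    []  : ∀ {x} → Steps R 0 x x
    _▷_ : ∀ {k x y z} → Steps R k x y → R y z → Steps R (suc k) x z

  module Forward
    (R : X → X → Set) (Final : X → Set)
    (functional : ∀ {x y y′} → R x y → R x y′ → y ≡ y′)
    (final-stuck : ∀ {x y} → Final x → ¬ R x y) where

    head-step : ∀ {k x z} → Steps R (suc k) x z → ∃ λ y → R x y × Steps R k y z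
    head-step ([] ▷ r) = _ , r , []
    head-step ((s ▷ r′) ▷ r) with head-step (s ▷ r′)
    ... | y , r₀ , s₀ = y , r₀ , s₀ ▷ r

    end-unique : ∀ {i j x y y′} → Steps R i x y → Final y → Steps R j x y′ → Final y′ → y ≡ y′
    end-unique {zero}  {zero}  [] _ [] _ = refl
    end-unique {zero}  {suc _} [] fin s _ with head-step s
    ... | _ , r , _ = contradiction r (final-stuck fin)
    end-unique {suc _} {zero}  s _ [] fin with head-step s
    ... | _ , r , _ = contradiction r (final-stuck fin)
    end-unique {suc _} {suc _} s fin s′ fin′ with head-step s | head-step s′
    ... | _ , r , t | _ , r′ , t′ with refl ← functional r r′ = end-unique t fin t′ fin′

  module Backward
    (R : X → X → Set) (Initial : X → Set)
    (injective : ∀ {x x′ y} → R x y → R x′ y → x ≡ x′)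
    (initial-unreached : ∀ {x y} → Initial y → ¬ R x y) where

    start-unique : ∀ {i j x x′ y} → Initial x → Steps R i x y → Initial x′ → Steps R j x′ y → x ≡ x′
    start-unique _ [] _ [] = refl
    start-unique ini [] _ (_ ▷ r) = contradiction r (initial-unreached ini)
    start-unique _ (_ ▷ r) ini [] = contradiction r (initial-unreached ini)
    start-unique ini (s ▷ r) ini′ (s′ ▷ r′) with refl ← injective r r′ = start-unique ini s ini′ s′

    -- Peeling last steps off both chains shortens the first one to length zero; then the initial
    -- point `x` itself would have a predecessor.
    no-repeat : ∀ {i j x y} → Initial x → i < j → Steps R i x y → ¬ Steps R j x y
    no-repeat ini _ [] (_ ▷ r) = initial-unreached ini r
    no-repeat ini (s≤s i<j) (s ▷ r) (s′ ▷ r′) with refl ← injective r r′ = no-repeat ini i<j s s′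

    prefix : ∀ {i k x y} → i ≤ k → Steps R k x y → ∃ λ z → Steps R i x z
    prefix z≤n s = _ , []
    prefix {k = suc k} i≤k (s ▷ r) with ℕ.m≤n⇒m<n∨m≡n i≤k
    ... | inj₁ i<k  = prefix (ℕ.≤-pred i<k) s
    ... | inj₂ refl = _ , s ▷ r

    module _ (P Final : X → Set) (progress : ∀ {x} → P x → Final x ⊎ ∃ λ y → R x y × P y) where

      run : ∀ k {x} → P x → (∃₂ λ i y → Steps R i x y × P y × Final y) ⊎ (∃ λ y → Steps R k x y × P y)
      run zero    p = inj₂ (_ , [] , p)
      run (suc k) p with run k p
      ... | inj₁ done = inj₁ done
      ... | inj₂ (y , s , py) with progress py
      ...   | inj₁ fin          = inj₁ (k , y , s , py , fin)
      ...   | inj₂ (z , r , pz) = inj₂ (z , s ▷ r , pz)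

      -- A run of `N` steps would visit `suc N` points, two of them with the same code, contrary to
      -- `no-repeat`.
      terminates : ∀ {x} → P x → Initial x → ∃₂ λ i y → Steps R i x y × P y × Final y
      terminates {x} p ini with run N p
      ... | inj₁ done = done
      ... | inj₂ (_ , s , _) with pigeonhole (ℕ.n<1+n N) (code ∘ proj₁ ∘ visited)
        where
        visited : (i : Fin (suc N)) → ∃ λ z → Steps R (toℕ i) x z
        visited i = prefix (ℕ.≤-pred (toℕ<n i)) s
      ... | i , j , i<j , e = contradiction
        (subst (Steps R _ x) (sym (code-injective e)) (proj₂ (prefix (ℕ.≤-pred (toℕ<n j)) s)))
        (no-repeat ini i<j (proj₂ (prefix (ℕ.≤-pred (toℕ<n i)) s)))

  module Reverse (R : X → X → Set) where
    cons : ∀ {k x y z} → R x y → Steps R k y z → Steps R (suc k) x z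
    cons r []       = [] ▷ r
    cons r (s ▷ r′) = cons r s ▷ r′

    reverse-steps : ∀ {k x y} → Steps (λ u v → R v u) k x y → Steps R k y x
    reverse-steps []      = []
    reverse-steps (s ▷ r) = cons r (reverse-steps s)

-- The signed set is carved out of `X` by `Signed`, with `true` for odd. By `odd-moves` every signed
-- fixed point is even, so no two fixed points have opposite signs.
record SignedInvolution (X : Set) : Set₁ where
  field
    Signed     : Bool → X → Set
    Fixed      : X → Set
    fixed?     : Decidable Fixed
    τ          : X → X
    τ-invol    : ∀ x → τ (τ x) ≡ x
    τ-reverses : ∀ {b x} → ¬ Fixed x → Signed b x → Signed (not b) (τ x)
    τ-unfixed  : ∀ {x} → ¬ Fixed x → ¬ Fixed (τ x)
    odd-moves  : ∀ {x} → Signed true x → ¬ Fixed x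

-- The Garsia–Milne involution principle: x ↦ τ (φ⁻¹ (τ′ (φ x))) is a partial injection on the even
-- part of the first set, and its maximal chains run from the fixed points of τ to the φ-preimages
-- of the fixed points of τ′.
module InvolutionPrinciple
  {X : Set} {N : ℕ} (code : X → Fin N) (code-injective : ∀ {x y} → code x ≡ code y → x ≡ y)
  (A B : SignedInvolution X) (φ φ⁻¹ : X → X)
  (φ-signed : ∀ {b x} → SignedInvolution.Signed A b x → SignedInvolution.Signed B b (φ x))
  (φ⁻¹-signed : ∀ {b y} → SignedInvolution.Signed B b y → SignedInvolution.Signed A b (φ⁻¹ y))
  (φ⁻¹∘φ : ∀ {b x} → SignedInvolution.Signed A b x → φ⁻¹ (φ x) ≡ x)
  (φ∘φ⁻¹ : ∀ {b y} → SignedInvolution.Signed B b y → φ (φ⁻¹ y) ≡ y)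
  where

  open SignedInvolution A
  open SignedInvolution B using () renaming
    (Signed to Signed′; Fixed to Fixed′; fixed? to fixed′?; τ to τ′; τ-invol to τ′-invol
    ; τ-reverses to τ′-reverses; τ-unfixed to τ′-unfixed; odd-moves to odd-moves′)

  End : X → Set
  End x = Fixed′ (φ x)

  advance retreat : X → X
  advance x = τ (φ⁻¹ (τ′ (φ x)))
  retreat x = φ⁻¹ (τ′ (φ (τ x)))

  -- `τ′` makes `φ x` odd and `φ⁻¹` keeps the sign. Odd points are moved by `τ`, so the last step of
  -- `advance` always returns to the even part.
  advance-odd : ∀ {x} → Signed false x → ¬ End x → Signed true (φ⁻¹ (τ′ (φ x)))
  advance-odd p ¬e = φ⁻¹-signed (τ′-reverses ¬e (φ-signed p))

  retreat-odd : ∀ {x} → Signed false x → ¬ Fixed x → Signed′ true (φ (τ x))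
  retreat-odd p ¬a = φ-signed (τ-reverses ¬a p)

  retreat-even : ∀ {x} → Signed false x → ¬ Fixed x → Signed′ false (τ′ (φ (τ x)))
  retreat-even p ¬a = τ′-reverses (odd-moves′ (retreat-odd p ¬a)) (retreat-odd p ¬a)

  advance-signed : ∀ {x} → Signed false x → ¬ End x → Signed false (advance x)
  advance-signed p ¬e = τ-reverses (odd-moves (advance-odd p ¬e)) (advance-odd p ¬e)

  advance-unfixed : ∀ {x} → Signed false x → ¬ End x → ¬ Fixed (advance x)
  advance-unfixed p ¬e = τ-unfixed (odd-moves (advance-odd p ¬e))

  retreat-advance : ∀ {x} → Signed false x → ¬ End x → retreat (advance x) ≡ x
  retreat-advance {x} p ¬e = begin
    φ⁻¹ (τ′ (φ (τ (advance x))))        ≡⟨ cong (λ y → φ⁻¹ (τ′ (φ y))) (τ-invol _) ⟩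
    φ⁻¹ (τ′ (φ (φ⁻¹ (τ′ (φ x)))))       ≡⟨ cong (λ y → φ⁻¹ (τ′ y)) (φ∘φ⁻¹ (τ′-reverses ¬e (φ-signed p))) ⟩
    φ⁻¹ (τ′ (τ′ (φ x)))                 ≡⟨ cong φ⁻¹ (τ′-invol _) ⟩
    φ⁻¹ (φ x)                           ≡⟨ φ⁻¹∘φ p ⟩
    x                                   ∎

  retreat-signed : ∀ {x} → Signed false x → ¬ Fixed x → Signed false (retreat x)
  retreat-signed p ¬a = φ⁻¹-signed (retreat-even p ¬a)

  φ-retreat : ∀ {x} → Signed false x → ¬ Fixed x → φ (retreat x) ≡ τ′ (φ (τ x))
  φ-retreat p ¬a = φ∘φ⁻¹ (retreat-even p ¬a)

  retreat-¬end : ∀ {x} → Signed false x → ¬ Fixed x → ¬ End (retreat x)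
  retreat-¬end p ¬a e = τ′-unfixed (odd-moves′ (retreat-odd p ¬a)) (subst Fixed′ (φ-retreat p ¬a) e)

  advance-retreat : ∀ {x} → Signed false x → ¬ Fixed x → advance (retreat x) ≡ x
  advance-retreat {x} p ¬a = begin
    τ (φ⁻¹ (τ′ (φ (retreat x))))  ≡⟨ cong (λ y → τ (φ⁻¹ (τ′ y))) (φ-retreat p ¬a) ⟩
    τ (φ⁻¹ (τ′ (τ′ (φ (τ x)))))   ≡⟨ cong (λ y → τ (φ⁻¹ y)) (τ′-invol _) ⟩
    τ (φ⁻¹ (φ (τ x)))             ≡⟨ cong τ (φ⁻¹∘φ (τ-reverses ¬a p)) ⟩
    τ (τ x)                       ≡⟨ τ-invol x ⟩
    x                             ∎

  Advances : X → X → Set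
  Advances x y = Signed false x × ¬ End x × advance x ≡ y

  open Chains code code-injective

  functional : ∀ {x y y′} → Advances x y → Advances x y′ → y ≡ y′
  functional (_ , _ , e) (_ , _ , e′) = trans (sym e) e′

  injective : ∀ {x x′ y} → Advances x y → Advances x′ y → x ≡ x′
  injective (p , ¬e , eq) (p′ , ¬e′ , eq′) =
    trans (sym (retreat-advance p ¬e)) (trans (cong retreat (trans eq (sym eq′))) (retreat-advance p′ ¬e′))

  fixed-unreached : ∀ {x y} → Fixed y → ¬ Advances x y
  fixed-unreached a (p , ¬e , refl) = advance-unfixed p ¬e a

  end-stuck : ∀ {x y} → End x → ¬ Advances x y
  end-stuck e (_ , ¬e , _) = ¬e e

  advance-progress : ∀ {x} → Signed false x → End x ⊎ ∃ λ y → Advances x y × Signed false y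
  advance-progress {x} p with fixed′? (φ x)
  ... | yes e = inj₁ e
  ... | no ¬e = inj₂ (_ , (p , ¬e , refl) , advance-signed p ¬e)

  retreat-progress : ∀ {y} → Signed false y → Fixed y ⊎ ∃ λ x → Advances x y × Signed false x
  retreat-progress {y} p with fixed? y
  ... | yes a = inj₁ a
  ... | no ¬a = inj₂ (_ , (retreat-signed p ¬a , retreat-¬end p ¬a , advance-retreat p ¬a) , retreat-signed p ¬a)

  module Fwd = Forward Advances End functional end-stuck
  module Bwd = Backward Advances Fixed injective fixed-unreached
  -- For the converse relation the two kinds of end points trade places, and functionality serves as
  -- injectivity.
  module Rev = Backward (λ x y → Advances y x) End functional end-stuck

  Even Even′ : X → Set
  Even  x = Signed false x × Fixed x
  Even′ y = Signed′ false y × Fixed′ y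

  -- A relation rather than a function: that it is single-valued and injective follows from the
  -- uniqueness of the two ends of a chain.
  Matched : X → X → Set
  Matched x y = ∃₂ λ i z → Steps Advances i x z × Signed false z × End z × φ z ≡ y

  matched-right : ∀ {x y} → Matched x y → Even′ y
  matched-right (_ , _ , _ , p , e , refl) = φ-signed p , e

  match : ∀ {x} → Even x → ∃ λ y → Matched x y
  match (p , a) with Bwd.terminates (Signed false) End advance-progress p a
  ... | i , z , s , pz , e = φ z , i , z , s , pz , e , refl

  match⁻¹ : ∀ {y} → Even′ y → ∃ λ x → Even x × Matched x y
  match⁻¹ {y} (p , a)
    with e ← subst Fixed′ (sym (φ∘φ⁻¹ p)) a
    with i , x , s , px , ax ← Rev.terminates (Signed false) Fixed retreat-progress (φ⁻¹-signed p) e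
    = x , (px , ax) , i , φ⁻¹ y , Reverse.reverse-steps Advances s , φ⁻¹-signed p , e , φ∘φ⁻¹ p

  matched-functional : ∀ {x y y′} → Matched x y → Matched x y′ → y ≡ y′
  matched-functional (_ , _ , s , _ , e , refl) (_ , _ , s′ , _ , e′ , refl) =
    cong φ (Fwd.end-unique s e s′ e′)

  matched-injective : ∀ {x x′ y} → Even x → Even x′ → Matched x y → Matched x′ y → x ≡ x′
  matched-injective (_ , a) (_ , a′) (_ , z , s , p , _ , c) (_ , z′ , s′ , p′ , _ , c′) =
    Bwd.start-unique a s a′ (subst (Steps Advances _ _) (sym z≡z′) s′)
    where
    z≡z′ : z ≡ z′
    z≡z′ = trans (sym (φ⁻¹∘φ p)) (trans (cong φ⁻¹ (trans c (sym c′))) (φ⁻¹∘φ p′))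

-- Configurations on a pinned path

lookup-ext : ∀ {A : Set} {n} {xs ys : Vec A n} → (∀ i → lookup xs i ≡ lookup ys i) → xs ≡ ys
lookup-ext {xs = xs} {ys} e = begin
  xs                   ≡⟨ tabulate∘lookup xs ⟨
  tabulate (lookup xs) ≡⟨ tabulate-cong e ⟩
  tabulate (lookup ys) ≡⟨ tabulate∘lookup ys ⟩
  ys                   ∎

parity : ∀ {n} → Vec Bool n → Bool
parity []       = false
parity (x ∷ xs) = x xor parity xs

parity-flip : ∀ {n} (M : Vec Bool n) i → parity (M [ i ]%= not) ≡ not (parity M)
parity-flip (x ∷ M) zero    = sym (Bool.not-distribˡ-xor x (parity M))
parity-flip (x ∷ M) (suc i) = trans (cong (x xor_) (parity-flip M i)) (sym (Bool.not-distribʳ-xor x (parity M)))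

parity-odd : ∀ {n} (M : Vec Bool n) → parity M ≡ true → ∃ λ i → lookup M i ≡ true
parity-odd (true ∷ M)  _ = zero , refl
parity-odd (false ∷ M) e with parity-odd M e
... | i , p = suc i , p

parity-replicate : ∀ n → parity (replicate n false) ≡ false
parity-replicate zero    = refl
parity-replicate (suc n) = parity-replicate n

-- Vectors instead of functions make pointwise equal configurations propositionally equal.
Config : ℕ → Set
Config n = Vec (Fin n) n × Vec Bool n

bit : Bool → Fin 2
bit false = zero
bit true  = suc zero

bit-injective : ∀ {a b} → bit a ≡ bit b → a ≡ b
bit-injective {false} {false} _ = refl
bit-injective {true}  {true}  _ = refl

codeVec : ∀ {A : Set} {m n} → (A → Fin m) → Vec A n → Fin (m ^ n)
codeVec c v = funToFin (c ∘ lookup v)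

codeVec-injective : ∀ {A : Set} {m n} (c : A → Fin m) → (∀ {a b} → c a ≡ c b → a ≡ b)
                  → {v w : Vec A n} → codeVec c v ≡ codeVec c w → v ≡ w
codeVec-injective c inj {v} {w} e = lookup-ext λ i → inj (begin
  c (lookup v i)             ≡⟨ finToFun-funToFin (c ∘ lookup v) i ⟨
  finToFun (codeVec c v) i   ≡⟨ cong (λ x → finToFun x i) e ⟩
  finToFun (codeVec c w) i   ≡⟨ finToFun-funToFin (c ∘ lookup w) i ⟩
  c (lookup w i)             ∎)

code : ∀ {n} → Config n → Fin (n ^ n * 2 ^ n)
code (f , M) = combine (codeVec (λ i → i) f) (codeVec bit M)

code-injective : ∀ {n} {x y : Config n} → code x ≡ code y → x ≡ y
code-injective {x = f , M} {g , L} e with combine-injective (codeVec (λ i → i) f) _ (codeVec (λ i → i) g) _ e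
... | p , q = cong₂ _,_ (codeVec-injective (λ i → i) (λ r → r) p) (codeVec-injective bit bit-injective q)

module _ {n : ℕ} (_~_ : Fin n → Fin n → Set) (~-sym : ∀ {u v} → u ~ v → v ~ u) where

  -- A path source = w₀ e₀ w₁ e₁ … eₘ₋₁ wₘ = sink whose odd vertices eᵢ (Pin) have no neighbours but
  -- prv eᵢ = wᵢ and nxt eᵢ = wᵢ₊₁; pred and succ are the shifts eᵢ ↦ eᵢ₋₁ and eᵢ ↦ eᵢ₊₁.
  record PinnedPath : Set₁ where
    field
      source sink       : Fin n
      Pin               : Fin n → Set
      Pin?              : Decidable Pin
      prv nxt pred succ : Fin n → Fin n
      source-unpinned   : ¬ Pin source
      sink-unpinned     : ¬ Pin sink
      prv-unpinned      : ∀ {e} → Pin e → ¬ Pin (prv e)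
      nxt-unpinned      : ∀ {e} → Pin e → ¬ Pin (nxt e)
      prv-adj           : ∀ {e} → Pin e → e ~ prv e
      nxt-adj           : ∀ {e} → Pin e → e ~ nxt e
      only-prv          : ∀ {e u} → Pin e → u ~ e → u ≢ nxt e → u ≡ prv e
      only-nxt          : ∀ {e u} → Pin e → u ~ e → u ≢ prv e → u ≡ nxt e
      pred-pin          : ∀ {e} → Pin e → prv e ≢ source → Pin (pred e)
      succ-pin          : ∀ {e} → Pin e → nxt e ≢ sink → Pin (succ e)
      nxt-pred          : ∀ {e} → Pin e → prv e ≢ source → nxt (pred e) ≡ prv e
      prv-succ          : ∀ {e} → Pin e → nxt e ≢ sink → prv (succ e) ≡ nxt e
      succ-pred         : ∀ {e} → Pin e → prv e ≢ source → succ (pred e) ≡ e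
      pred-succ         : ∀ {e} → Pin e → nxt e ≢ sink → pred (succ e) ≡ e

  open PinnedPath

  -- `opposite (opposite π)` is `π` by record eta, so every fact about a path and its opposite can
  -- be used in both directions.
  opposite : PinnedPath → PinnedPath
  opposite π = record
    { source = sink π ; sink = source π ; Pin = Pin π ; Pin? = Pin? π
    ; prv = nxt π ; nxt = prv π ; pred = succ π ; succ = pred π
    ; source-unpinned = sink-unpinned π ; sink-unpinned = source-unpinned π
    ; prv-unpinned = nxt-unpinned π ; nxt-unpinned = prv-unpinned π
    ; prv-adj = nxt-adj π ; nxt-adj = prv-adj π
    ; only-prv = only-nxt π ; only-nxt = only-prv π
    ; pred-pin = succ-pin π ; succ-pin = pred-pin π
    ; nxt-pred = prv-succ π ; prv-succ = nxt-pred π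
    ; succ-pred = pred-succ π ; pred-succ = succ-pred π
    }

  -- The canonical vertex of a cycle of f avoiding r.
  CycleMin : (Fin n → Fin n) → Fin n → Fin n → Set
  CycleMin f r w = Cyclic f w × (∀ u → Reach f w u → toℕ w ≤ toℕ u) × ¬ Reach f w r

  cycleMin? : ∀ f r → Decidable (CycleMin f r)
  cycleMin? f r w = reach? f (f w) w
    ×-dec all? (λ u → reach? f w u →-dec (toℕ w ℕ.≤? toℕ u))
    ×-dec ¬? (reach? f w r)

  -- A cycle through `r` remains allowed, since every valid configuration has one through its sink.
  Acyclic : (Fin n → Fin n) → Fin n → Set
  Acyclic f r = ∀ w → ¬ CycleMin f r w

  -- The walk from `u` ends in a cycle. If it never meets `r`, the least vertex of that cycle is a
  -- `CycleMin`.
  acyclic-reach : ∀ f r → Acyclic f r → ∀ u → Reach f u r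
  acyclic-reach f r acyc u with reach? f u r
  ... | yes p = p
  ... | no ¬p with reach-cyclic f u
  ... | v , uv , cyc with least (reach? f v) (reach-refl f)
  ... | w , vw , min = contradiction
    ( cyclic-reach f cyc vw
    , (λ x wx → min x (reach-trans f vw wx))
    , λ wr → ¬p (reach-trans f uv (reach-trans f vw wr)))
    (acyc w)

  -- The cycle through the sink always counts as marked.
  Marked : PinnedPath → Vec Bool n → Fin n → Set
  Marked π M w = w ≡ sink π ⊎ lookup M w ≡ true

  marked? : ∀ π M → Decidable (Marked π M)
  marked? π M w = (w ≟ sink π) ⊎-dec (lookup M w Bool.≟ true)

  -- In a valid configuration marked vertices are cyclic, so what they reach is exactly the union of
  -- the marked cycles.
  OnMarked : PinnedPath → Config n → Fin n → Set
  OnMarked π (f , M) u = ∃ λ w → Marked π M w × Reach (lookup f) w u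

  onMarked? : ∀ π x → Decidable (OnMarked π x)
  onMarked? π (f , M) u = any? λ w → marked? π M w ×-dec reach? (lookup f) w u

  -- Given along, into-pin says that f never steps from nxt e back to the pinned vertex e.
  record Valid (π : PinnedPath) (x : Config n) : Set where
    f = lookup (proj₁ x)
    M = proj₂ x
    field
      at-sink   : f (sink π) ≡ source π
      at-pin    : ∀ {e} → Pin π e → f e ≡ nxt π e
      along     : ∀ {u} → u ≢ sink π → u ~ f u
      into-pin  : ∀ {u} → Pin π (f u) → u ≡ prv π (f u)
      sink-cyclic : Cyclic f (sink π)
      marks     : ∀ {w} → lookup M w ≡ true → CycleMin f (sink π) w

  -- Reversal of a configuration

  reroute : PinnedPath → (Fin n → Fin n) → Fin n → Fin n
  reroute π f u with Pin? π u | Pin? π (f u)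
  ... | yes _ | _     = prv π u
  -- In a valid configuration `u` is the `prv` of the pinned vertex `f u`. On the opposite path `u`
  -- may enter only the pinned vertex whose `nxt` is `u`, which is `pred`.
  ... | no  _ | yes _ = pred π (f u)
  ... | no  _ | no  _ = f u

  -- A vertex on a marked cycle goes to its predecessor there. The decision is an argument so that
  -- proofs can split on it.
  flipAt : (π : PinnedPath) (x : Config n) → ∀ u → Dec (∃ λ v → OnMarked π x v × lookup (proj₁ x) v ≡ u) → Fin n
  flipAt π x u (yes (v , _)) = v
  flipAt π x u (no _)        = reroute π (lookup (proj₁ x)) u

  opaque
    flipParents : PinnedPath → Config n → Vec (Fin n) n
    flipParents π x = tabulate λ u → flipAt π x u (any? λ v → onMarked? π x v ×-dec (lookup (proj₁ x) v ≟ u))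

    flipParents-lookup : ∀ π x u → lookup (flipParents π x) u
      ≡ flipAt π x u (any? λ v → onMarked? π x v ×-dec (lookup (proj₁ x) v ≟ u))
    flipParents-lookup π x u = lookup∘tabulate _ u

  flip : PinnedPath → Config n → Config n
  flip π x = flipParents π x , proj₂ x

  module Flip (π : PinnedPath) (x : Config n) (valid : Valid π x) where
    open Valid valid
    r = sink π
    s = source π
    π′ = opposite π
    x′ = flip π x
    g = lookup (proj₁ x′)
    S = OnMarked π x

    g-def : ∀ u → g u ≡ flipAt π x u (any? λ v → onMarked? π x v ×-dec (f v ≟ u))
    g-def = flipParents-lookup π x

    marked-cyclic : ∀ {w} → Marked π M w → Cyclic f w
    marked-cyclic (inj₁ refl) = sink-cyclic
    marked-cyclic (inj₂ e)    = proj₁ (marks e)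

    S-cyclic : ∀ {u} → S u → Cyclic f u
    S-cyclic (w , m , p) = cyclic-reach f (marked-cyclic m) p

    S-reach : ∀ {u v} → S u → Reach f u v → S v
    S-reach (w , m , p) q = w , m , reach-trans f p q

    S-step : ∀ {u} → S u → S (f u)
    S-step h = S-reach h (1 , refl)

    S-sink : S r
    S-sink = r , inj₁ refl , reach-refl f

    S-source : S s
    S-source = subst S at-sink (S-step S-sink)

    S-preimage : ∀ {u} → S u → ∃ λ v → S v × f v ≡ u
    S-preimage {u} h with S-cyclic h
    ... | k , e = iter f k u , S-reach h (k , refl) , trans (sym (iter-comm f k 1 u)) e

    -- The predecessor found by the search is `v`, because `f` is injective on cyclic vertices.
    g-in : ∀ {v} → S v → g (f v) ≡ v
    g-in {v} h = trans (g-def (f v)) (lemma (any? λ w → onMarked? π x w ×-dec (f w ≟ f v)))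
      where
      lemma : ∀ d → flipAt π x (f v) d ≡ v
      lemma (yes (w , h′ , e)) = cyclic-injective f (S-cyclic h′) (S-cyclic h) e
      lemma (no ¬p)            = contradiction (v , h , refl) ¬p

    g-out : ∀ {u} → ¬ S u → g u ≡ reroute π f u
    g-out {u} ¬h = trans (g-def u) (lemma (any? λ w → onMarked? π x w ×-dec (f w ≟ u)))
      where
      lemma : ∀ d → flipAt π x u d ≡ reroute π f u
      lemma (yes (w , h′ , e)) = contradiction (subst S e (S-step h′)) ¬h
      lemma (no ¬p)            = refl

    g-S : ∀ {u} → S u → S (g u) × f (g u) ≡ u
    g-S h with S-preimage h
    ... | v , hv , refl = subst S (sym (g-in hv)) hv , cong f (g-in hv)

    reach-fg : ∀ {u v} → S u → Reach f u v → Reach g v u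
    reach-fg h (zero  , refl) = 0 , refl
    reach-fg {u} h (suc k , refl) =
      reach-trans g (1 , g-in (S-reach h (k , refl))) (reach-fg h (k , refl))

    reach-gf : ∀ {u v} → S u → Reach g u v → S v × Reach f v u
    reach-gf h (zero  , refl) = h , 0 , refl
    reach-gf h (suc k , refl) with reach-gf h (k , refl)
    ... | hv , p = proj₁ (g-S hv) , reach-trans f (1 , proj₂ (g-S hv)) p

    reach-gf′ : ∀ {u v} → S u → Reach g u v → Reach f u v
    reach-gf′ h p with reach-gf h p
    ... | hv , q = reach-sym f (S-cyclic hv) q

    g-cyclic : ∀ {u} → S u → Cyclic g u
    g-cyclic {u} h = reach-fg h (reach-gf′ h (1 , refl))

    S-marked : ∀ {w} → lookup M w ≡ true → S w
    S-marked {w} m = w , inj₂ m , reach-refl f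

    -- The new sink `s` lies on the cycle of the old one, because `r` steps to `s`; so both
    -- orientations count the same root cycle as marked.
    S⇒S′ : ∀ {u} → S u → OnMarked π′ x′ u
    S⇒S′ {u} h@(w , inj₁ refl , p) =
      s , inj₁ refl , reach-fg h (subst (Reach f u) at-sink (reach-step f (reach-sym f sink-cyclic p)))
    S⇒S′ h@(w , inj₂ m , p) =
      w , inj₂ m , reach-fg h (reach-sym f (marked-cyclic (inj₂ m)) p)

    S′⇒S : ∀ {u} → OnMarked π′ x′ u → S u
    S′⇒S (w , inj₁ refl , p) = proj₁ (reach-gf S-source p)
    S′⇒S (w , inj₂ m , p)    = proj₁ (reach-gf (S-marked m) p)

    out≢sink : ∀ {u} → ¬ S u → u ≢ r
    out≢sink ¬h refl = ¬h S-sink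

    out≢source : ∀ {u} → ¬ S u → u ≢ s
    out≢source ¬h refl = ¬h S-source

    -- The source lies on the root cycle, so no vertex off `S` equals it. Hence `f u` is not the
    -- first pinned vertex and has a genuine `pred`.
    prv≢source : ∀ {u} → ¬ S u → Pin π (f u) → prv π (f u) ≢ s
    prv≢source ¬h p e = out≢source ¬h (trans (into-pin p) e)

    -- A view of `g` off `S`; the equation in `into` is what adjacency and `into-pin` for the
    -- opposite path rest on.
    data Rerouted (u : Fin n) : Fin n → Set where
      at      : Pin π u → Rerouted u (prv π u)
      into    : ¬ Pin π u → Pin π (f u) → nxt π (pred π (f u)) ≡ u → Rerouted u (pred π (f u))
      neither : ¬ Pin π u → ¬ Pin π (f u) → Rerouted u (f u)

    rerouted : ∀ {u} → ¬ S u → Rerouted u (g u)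
    rerouted {u} ¬h = subst (Rerouted u) (sym (g-out ¬h)) view
      where
      view : Rerouted u (reroute π f u)
      view with Pin? π u | Pin? π (f u)
      ... | yes p | _     = at p
      ... | no ¬p | yes q = into ¬p q (trans (nxt-pred π q (prv≢source ¬h q)) (sym (into-pin q)))
      ... | no ¬p | no ¬q = neither ¬p ¬q

    pred-pinned : ∀ {u} → ¬ S u → Pin π (f u) → Pin π (pred π (f u))
    pred-pinned ¬h q = pred-pin π q (prv≢source ¬h q)

    flip-valid : Valid π′ x′
    flip-valid = record
      { at-sink = trans (cong g (sym at-sink)) (g-in S-sink)
      ; at-pin = at-pin′
      ; along = along′
      ; into-pin = into-pin′
      ; sink-cyclic = g-cyclic S-source
      -- Reversal keeps the vertex set of a cycle, hence its least vertex. Avoiding `s` amounts to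
      -- avoiding `r`, since both lie on the root cycle.
      ; marks = λ m → let h = S-marked m ; c , min , avoid = marks m in
          g-cyclic h
        , (λ u p → min u (reach-gf′ h p))
        , (λ p → avoid (reach-trans f (reach-gf′ h p) (reach-sym f sink-cyclic (1 , at-sink))))
      }
      where
      -- On a marked cycle, `into-pin` identifies the predecessor of a pinned vertex as its `prv`;
      -- off the marked cycles this is the case `at`.
      at-pin′ : ∀ {e} → Pin π e → g e ≡ prv π e
      at-pin′ {e} p with onMarked? π x e
      ... | yes h = let hg , eq = g-S h in
        trans (into-pin (subst (Pin π) (sym eq) p)) (cong (prv π) eq)
      ... | no ¬h with g e | rerouted ¬h
      ... | _ | at _         = refl
      ... | _ | into ¬p _ _  = contradiction p ¬p
      ... | _ | neither ¬p _ = contradiction p ¬p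

      along′ : ∀ {u} → u ≢ s → u ~ g u
      along′ {u} u≢s with onMarked? π x u
      -- The only step of `f` that need not follow an edge is `r` to `s`; reversed it starts at `s`,
      -- which is excluded here.
      ... | yes h = let hg , eq = g-S h in
        ~-sym (subst (g u ~_) eq (along λ g≡r → u≢s (trans (sym eq) (trans (cong f g≡r) at-sink))))
      ... | no ¬h with g u | rerouted ¬h
      ... | _ | at p        = prv-adj π p
      ... | _ | into _ q e  = ~-sym (subst (pred π (f u) ~_) e (nxt-adj π (pred-pinned ¬h q)))
      ... | _ | neither _ _ = along (out≢sink ¬h)

      into-pin′ : ∀ {u} → Pin π (g u) → u ≡ nxt π (g u)
      into-pin′ {u} p with onMarked? π x u
      ... | yes h = let hg , eq = g-S h in trans (sym eq) (at-pin p)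
      ... | no ¬h with g u | rerouted ¬h
      ... | _ | at q         = contradiction p (prv-unpinned π q)
      ... | _ | into _ _ e   = sym e
      ... | _ | neither _ ¬q = contradiction p ¬q

  module _ (π : PinnedPath) (x : Config n) (valid : Valid π x) where
    open Valid valid
    private
      module F = Flip π x valid
      module F′ = Flip (opposite π) (flip π x) F.flip-valid

    -- Both flips have the same marked vertices. There the inverse of `f` is inverted again;
    -- elsewhere only equal cases of the two views are consistent, and `succ` undoes `pred`.
    flip-involutive : flip (opposite π) (flip π x) ≡ x
    flip-involutive = cong (_, M) (lookup-ext pointwise)
      where
      pointwise : ∀ u → F′.g u ≡ f u
      pointwise u with onMarked? π x u
      ... | yes h = trans (cong F′.g (sym (F.g-in h))) (F′.g-in (F.S⇒S′ (F.S-step h)))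
      ... | no ¬h with F.g u in eq | F.rerouted ¬h | F′.g u | F′.rerouted (¬h ∘ F.S′⇒S)
      ... | _ | F.at p | _ | F′.at _         = sym (at-pin p)
      ... | _ | F.at p | _ | F′.into ¬p _ _  = contradiction p ¬p
      ... | _ | F.at p | _ | F′.neither ¬p _ = contradiction p ¬p
      ... | _ | F.into ¬p _ _  | _ | F′.at p         = contradiction p ¬p
      ... | _ | F.into _ q _   | _ | F′.into _ _ _   =
        trans (cong (succ π) eq) (succ-pred π q (F.prv≢source ¬h q))
      ... | _ | F.into _ q _   | _ | F′.neither _ ¬q = contradiction (subst (Pin π) (sym eq) (F.pred-pinned ¬h q)) ¬q
      ... | _ | F.neither ¬p _ | _ | F′.at p         = contradiction p ¬p
      ... | _ | F.neither _ ¬q | _ | F′.into _ q _   = contradiction (subst (Pin π) eq q) ¬q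
      ... | _ | F.neither _ _  | _ | F′.neither _ _  = eq

  AcyclicConfig : PinnedPath → Config n → Set
  AcyclicConfig π (f , M) = Acyclic (lookup f) (sink π)

  -- The sign-reversing involution on configurations

  toggleAt : ∀ {P : Fin n → Set} → Dec (∃ P) → Vec Bool n → Vec Bool n
  toggleAt (yes (w , _)) M = M [ w ]%= not
  toggleAt (no _)        M = M

  toggle : PinnedPath → Config n → Config n
  toggle π (f , M) = f , toggleAt (any? (cycleMin? (lookup f) (sink π))) M

  -- The cycle to toggle is chosen from `f` alone, so the second toggle finds the same one.
  toggle-involutive : ∀ π x → toggle π (toggle π x) ≡ x
  toggle-involutive π (f , M) with any? (cycleMin? (lookup f) (sink π))
  ... | no _        = refl
  ... | yes (w , _) = cong (f ,_) (begin
    (M [ w ]%= not) [ w ]%= not ≡⟨ updateAt-updateAt w M ⟩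
    M [ w ]%= (not ∘ not)       ≡⟨ updateAt-cong w Bool.not-involutive M ⟩
    M [ w ]%= (λ b → b)         ≡⟨ updateAt-id w M ⟩
    M                           ∎)

  toggle-parity : ∀ π x → ¬ AcyclicConfig π x → parity (proj₂ (toggle π x)) ≡ not (parity (proj₂ x))
  toggle-parity π (f , M) ¬a with any? (cycleMin? (lookup f) (sink π))
  ... | yes (w , _) = parity-flip M w
  ... | no none     = contradiction (λ w c → none (w , c)) ¬a

  toggle-valid : ∀ π x → Valid π x → Valid π (toggle π x)
  toggle-valid π x@(f , M) v = record
    { at-sink = at-sink ; at-pin = at-pin ; along = along ; into-pin = into-pin
    ; sink-cyclic = sink-cyclic
    ; marks = marks′ (any? (cycleMin? (lookup f) (sink π)))
    }
    where
    open Valid v hiding (f; M)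
    marks′ : ∀ d {w} → lookup (toggleAt d M) w ≡ true → CycleMin (lookup f) (sink π) w
    marks′ (no _) = marks
    marks′ (yes (u , c)) {w} m with w ≟ u
    ... | yes refl = c
    ... | no w≢u   = marks (trans (sym (lookup∘updateAt′ w u w≢u M)) m)

  Signed : Bool → PinnedPath → Config n → Set
  Signed b π x = Valid π x × parity (proj₂ x) ≡ b

  flip-signed : ∀ {b} π x → Signed b π x → Signed b (opposite π) (flip π x)
  flip-signed π x (v , e) = Flip.flip-valid π x v , e

  toggle-signed : ∀ {b} π x → ¬ AcyclicConfig π x → Signed b π x → Signed (not b) π (toggle π x)
  toggle-signed π x ¬a (v , e) = toggle-valid π x v , trans (toggle-parity π x ¬a) (cong not e)

  -- An odd number of marks is not zero, and any mark sits on a cycle avoiding the sink.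
  odd-cyclic : ∀ π x → Signed true π x → ¬ AcyclicConfig π x
  odd-cyclic π (f , M) (v , e) a with parity-odd M e
  ... | w , m = a w (Valid.marks v m)

  acyclic? : ∀ f r → Dec (Acyclic f r)
  acyclic? f r = all? λ w → ¬? (cycleMin? f r w)

  signedInvolution : PinnedPath → SignedInvolution (Config n)
  signedInvolution π = record
    { Signed     = λ b → Signed b π
    ; Fixed      = AcyclicConfig π
    ; fixed?     = λ x → acyclic? (lookup (proj₁ x)) (sink π)
    ; τ          = toggle π
    ; τ-invol    = toggle-involutive π
    ; τ-reverses = λ {_} {x} → toggle-signed π x
    ; τ-unfixed  = λ ¬a → ¬a
    ; odd-moves  = λ {x} → odd-cyclic π x
    }

  -- Rooted trees as unmarked acyclic configurations

  record PinnedTree (π : PinnedPath) (par : Fin n → Fin n) : Set where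
    field
      root-fixed : par (sink π) ≡ sink π
      edges      : ∀ u → u ≢ sink π → u ~ par u
      rooted     : ∀ u → Reach par u (sink π)
      pins       : ∀ {e} → Pin π e → par e ≡ nxt π e

  -- With the source as target this closes a tree to a configuration; with `t = r` it restores the
  -- convention that the root is its own parent.
  redirect : Fin n → Fin n → (Fin n → Fin n) → Fin n → Fin n
  redirect r t f u with u ≟ r
  ... | yes _ = t
  ... | no  _ = f u

  redirect-at : ∀ r t f → redirect r t f r ≡ t
  redirect-at r t f with r ≟ r
  ... | yes _  = refl
  ... | no r≢r = contradiction refl r≢r

  redirect-off : ∀ r t f {u} → u ≢ r → redirect r t f u ≡ f u
  redirect-off r t f {u} u≢r with u ≟ r
  ... | yes e = contradiction e u≢r
  ... | no _  = refl

  -- A walk uses the value at `r` only after it has arrived there.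
  reach-agree : ∀ {f g : Fin n → Fin n} {r} → (∀ {u} → u ≢ r → f u ≡ g u)
              → ∀ k u → iter f k u ≡ r → Reach g u r
  reach-agree agree zero u e = 0 , e
  reach-agree {f} {g} {r} agree (suc k) u e with u ≟ r
  ... | yes u≡r = 0 , u≡r
  ... | no u≢r  = reach-trans g (1 , sym (agree u≢r))
                    (reach-agree agree k (f u) (trans (iter-comm f k 1 u) e))

  -- The walk alternates between `u` and `e`: `go` shows that no iterate differs from both.
  two-cycle-stuck : ∀ {f : Fin n → Fin n} {u e r} → f u ≡ e → f e ≡ u → u ≢ r → e ≢ r → ¬ Reach f u r
  two-cycle-stuck {f} {u} {e} fu fe u≢r e≢r (k , p) = go k
    (λ q → u≢r (trans (sym q) p)) (λ q → e≢r (trans (sym q) p))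
    where
    go : ∀ k → iter f k u ≢ u → ¬ (iter f k u ≢ e)
    go zero    a _ = a refl
    go (suc k) a b = go k (λ q → b (trans (cong f q) fu)) (λ q → a (trans (cong f q) fe))

  unmarked : Vec Bool n
  unmarked = replicate n false

  close : PinnedPath → (Fin n → Fin n) → Config n
  close π par = tabulate (redirect (sink π) (source π) par) , unmarked

  unclose : PinnedPath → Config n → Fin n → Fin n
  unclose π x = redirect (sink π) (sink π) (lookup (proj₁ x))

  module _ (π : PinnedPath) where
    private
      r = sink π
      s = source π

    module _ (par : Fin n → Fin n) (tree : PinnedTree π par) where
      open PinnedTree tree
      private
        f = lookup (proj₁ (close π par))
        f-sink : f r ≡ s
        f-sink = trans (lookup∘tabulate _ r) (redirect-at r s par)
        f-off : ∀ {u} → u ≢ r → f u ≡ par u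
        f-off {u} u≢r = trans (lookup∘tabulate _ u) (redirect-off r s par u≢r)
        pin≢sink : ∀ {e} → Pin π e → e ≢ r
        pin≢sink p refl = sink-unpinned π p
        f-rooted : ∀ u → Reach f u r
        f-rooted u = let k , e = rooted u in reach-agree (sym ∘ f-off) k u e

      close-acyclic : AcyclicConfig π (close π par)
      close-acyclic w (_ , _ , avoid) = avoid (f-rooted w)

      close-signed : Signed false π (close π par)
      close-signed = record
        { at-sink = f-sink
        ; at-pin = λ p → trans (f-off (pin≢sink p)) (pins p)
        ; along = λ {u} u≢r → subst (u ~_) (sym (f-off u≢r)) (edges u u≢r)
        ; into-pin = into-pin′
        ; sink-cyclic = f-rooted (f r)
        ; marks = λ {w} m → contradiction (trans (sym m) (lookup-replicate w false)) λ ()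
        } , parity-replicate n
        where
        into-pin′ : ∀ {u} → Pin π (f u) → u ≡ prv π (f u)
        into-pin′ {u} p with u ≟ r
        ... | yes refl = contradiction (subst (Pin π) f-sink p) (source-unpinned π)
        -- If `u` were the `nxt` of the pinned vertex `f u`, the two would form a two-cycle and `u`
        -- could not reach the root.
        ... | no u≢r = only-prv π p (subst (u ~_) (sym (f-off u≢r)) (edges u u≢r)) λ e →
                two-cycle-stuck {f} refl (trans (f-off (pin≢sink p)) (trans (pins p) (sym e)))
                  u≢r (pin≢sink p) (f-rooted u)

      open-close : ∀ u → unclose π (close π par) u ≡ par u
      open-close u with u ≟ r
      ... | yes refl = sym root-fixed
      ... | no u≢r   = f-off u≢r

    close-cong : ∀ {par par′} → (∀ u → par u ≡ par′ u) → close π par ≡ close π par′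
    close-cong {par} {par′} e = cong (_, unmarked) (tabulate-cong pointwise)
      where
      pointwise : ∀ u → redirect r s par u ≡ redirect r s par′ u
      pointwise u with u ≟ r
      ... | yes _ = refl
      ... | no _  = e u

    module _ (x : Config n) (v : Valid π x) (a : AcyclicConfig π x) where
      open Valid v

      open-tree : PinnedTree π (unclose π x)
      open-tree = record
        { root-fixed = redirect-at r r f
        ; edges = λ u u≢r → subst (u ~_) (sym (redirect-off r r f u≢r)) (along u≢r)
        ; rooted = λ u → let k , e = acyclic-reach f r a u in reach-agree (sym ∘ redirect-off r r f) k u e
        ; pins = λ {e} p → trans (redirect-off r r f {e} λ e≡r → sink-unpinned π (subst (Pin π) e≡r p)) (at-pin p)
        }

      close-open : close π (unclose π x) ≡ x
      close-open = cong₂ _,_ (lookup-ext λ u → trans (lookup∘tabulate _ u) (parents u)) (lookup-ext no-marks)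
        where
        parents : ∀ u → redirect r s (redirect r r f) u ≡ f u
        parents u with u ≟ r
        ... | yes refl = sym at-sink
        ... | no u≢r   = redirect-off r r f u≢r
        no-marks : ∀ w → lookup unmarked w ≡ lookup M w
        no-marks w with lookup M w in eq
        ... | false = lookup-replicate w false
        ... | true  = contradiction (marks eq) (a w)

  -- Matching the trees of a path with those of its opposite

  module TreeBijection (π : PinnedPath) where
    private π′ = opposite π

    module Principle = InvolutionPrinciple code code-injective (signedInvolution π) (signedInvolution π′)
      (flip π) (flip π′) (λ {_} {x} → flip-signed π x) (λ {_} {x} → flip-signed π′ x)
      (λ {_} {x} p → flip-involutive π x (proj₁ p)) (λ {_} {x} p → flip-involutive π′ x (proj₁ p))
    open Principle using (Even; Even′; Matched; match; match⁻¹; matched-right; matched-functional; matched-injective)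

    Corresponds : (Fin n → Fin n) → (Fin n → Fin n) → Set
    Corresponds par par′ = Matched (close π par) (close π′ par′)

    close-even : ∀ {par} → PinnedTree π par → Even (close π par)
    close-even {par} t = close-signed π par t , close-acyclic π par t

    close-even′ : ∀ {par} → PinnedTree π′ par → Even′ (close π′ par)
    close-even′ {par} t = close-signed π′ par t , close-acyclic π′ par t

    corresponding : ∀ {par} → PinnedTree π par → ∃ λ par′ → PinnedTree π′ par′ × Corresponds par par′
    corresponding {par} t =
      let y , m = match (close-even t)
          p , a = matched-right {close π par} m
      in unclose π′ y , open-tree π′ y (proj₁ p) a
                  , subst (Matched (close π par)) (sym (close-open π′ y (proj₁ p) a)) m

    corresponding⁻¹ : ∀ {par′} → PinnedTree π′ par′ → ∃ λ par → PinnedTree π par × Corresponds par par′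
    corresponding⁻¹ {par′} t =
      let x , (p , a) , m = match⁻¹ (close-even′ t)
      in unclose π x , open-tree π x (proj₁ p) a
                  , subst (λ z → Matched z (close π′ par′)) (sym (close-open π x (proj₁ p) a)) m

    close-injective : ∀ ρ {par par′} → PinnedTree ρ par → PinnedTree ρ par′
                    → close ρ par ≡ close ρ par′ → ∀ u → par u ≡ par′ u
    close-injective ρ {par} {par′} t t′ e u =
      trans (sym (open-close ρ par t u)) (trans (cong (λ x → unclose ρ x u) e) (open-close ρ par′ t′ u))

    -- Trees are compared pointwise, as in `TreeSetoid`. `close` turns pointwise equal parent
    -- functions into equal configurations, to which the uniqueness of matching applies.
    corresponds-functional : ∀ {par₁ par₂ par₁′ par₂′}
      → PinnedTree π′ par₁′ → PinnedTree π′ par₂′ → (∀ u → par₁ u ≡ par₂ u)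
      → Corresponds par₁ par₁′ → Corresponds par₂ par₂′ → ∀ u → par₁′ u ≡ par₂′ u
    corresponds-functional {par₁} {par₂′ = par₂′} t t′ eq c c′ = close-injective π′ t t′
      (matched-functional {close π par₁} c (subst (λ x → Matched x (close π′ par₂′)) (sym (close-cong π eq)) c′))

    corresponds-injective : ∀ {par₁ par₂ par₁′ par₂′}
      → PinnedTree π par₁ → PinnedTree π par₂ → (∀ u → par₁′ u ≡ par₂′ u)
      → Corresponds par₁ par₁′ → Corresponds par₂ par₂′ → ∀ u → par₁ u ≡ par₂ u
    corresponds-injective {par₂ = par₂} t t′ eq c c′ = close-injective π t t′
      (matched-injective (close-even t) (close-even t′) c (subst (Matched (close π par₂)) (sym (close-cong π′ eq)) c′))

-- Plane graphs

countᵇ-filterᵇ : ∀ {A : Set} (q : A → Bool) xs → countᵇ q xs ≡ length (filterᵇ q xs)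
countᵇ-filterᵇ q []       = refl
countᵇ-filterᵇ q (x ∷ xs) with q x
... | true  = cong suc (countᵇ-filterᵇ q xs)
... | false = countᵇ-filterᵇ q xs

two-members : ∀ {A : Set} {l : List A} {x y z} → length l ≡ 2 → x ∈ l → y ∈ l → z ∈ l → x ≢ y → z ≡ x ⊎ z ≡ y
two-members {l = _ ∷ _ ∷ []} _ (here refl) (here refl) _ x≢y = contradiction refl x≢y
two-members {l = _ ∷ _ ∷ []} _ (here refl) (there (here refl)) (here refl) _ = inj₁ refl
two-members {l = _ ∷ _ ∷ []} _ (here refl) (there (here refl)) (there (here refl)) _ = inj₂ refl
two-members {l = _ ∷ _ ∷ []} _ (there (here refl)) (here refl) (here refl) _ = inj₂ refl
two-members {l = _ ∷ _ ∷ []} _ (there (here refl)) (here refl) (there (here refl)) _ = inj₁ refl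
two-members {l = _ ∷ _ ∷ []} _ (there (here refl)) (there (here refl)) _ x≢y = contradiction refl x≢y

module _ (G : PlaneGraph) where

  Adj-sym : ∀ {u v} → Adj G u v → Adj G v u
  Adj-sym (x , t , h) = rev G x , h , trans (cong (tail G) (rev-invol G x)) t

  BoundaryEdge⇒Adj : ∀ {f u v} → BoundaryEdge G f u v → Adj G u v
  BoundaryEdge⇒Adj (x , t , h , _) = x , t , h

  -- Distinct neighbours come from distinct darts, and these exhaust the two darts at `e`.
  degree-two : ∀ {e a b c} → degree G e ≡ 2 → Adj G e a → Adj G e b → Adj G e c → a ≢ b → c ≡ a ⊎ c ≡ b
  degree-two {e} deg (x , tx , refl) (y , ty , refl) (z , tz , refl) a≢b
    with two-members (trans (sym (countᵇ-filterᵇ _ (allFin (d G)))) deg)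
           (dart x tx) (dart y ty) (dart z tz) (a≢b ∘ cong (head G))
    where
    dart : ∀ x → tail G x ≡ e → x ∈ filterᵇ _ (allFin (d G))
    dart x t = ∈-filter⁺ _ (∈-allFin x) (fromWitness t)
  ... | inj₁ refl = inj₁ refl
  ... | inj₂ refl = inj₂ refl

  -- The path vertices of odd index as pinned vertices

  module _ (m : ℕ) (p : ℕ → Fin (V G))
    (p-injective : ∀ i j → i ≤ 2 * m → j ≤ 2 * m → p i ≡ p j → i ≡ j)
    (p-edge : ∀ i → i < 2 * m → Adj G (p i) (p (suc i)))
    (p-degree : ∀ j → j < m → degree G (p (2 * j + 1)) ≡ 2) where

    odd-< : ∀ {j} → j < m → 2 * j + 1 < 2 * m
    odd-< {j} j<m = ℕ.≤-trans (ℕ.≤-reflexive eq) (ℕ.*-monoʳ-≤ 2 j<m)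
      where
      eq : suc (2 * j + 1) ≡ 2 * suc j
      eq = trans (cong suc (ℕ.+-comm (2 * j) 1)) (sym (ℕ.*-suc 2 j))

    after-odd : ∀ j → 2 * j + 2 ≡ suc (2 * j + 1)
    after-odd j = ℕ.+-suc (2 * j) 1

    2*suc : ∀ j → 2 * j + 2 ≡ 2 * suc j
    2*suc j = trans (ℕ.+-comm (2 * j) 2) (sym (ℕ.*-suc 2 j))

    Odd : Fin (V G) → Set
    Odd u = ∃ λ j → j < m × p (2 * j + 1) ≡ u

    odd? : ∀ u → Dec (Odd u)
    odd? u = map′ (λ (j , e) → toℕ j , toℕ<n j , e)
      (λ (j , j<m , e) → fromℕ< j<m , trans (cong (λ i → p (2 * i + 1)) (toℕ-fromℕ< j<m)) e)
      (any? λ (j : Fin m) → p (2 * toℕ j + 1) ≟ u)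

    odd-unique : ∀ {i j} → i < m → j < m → p (2 * i + 1) ≡ p (2 * j + 1) → i ≡ j
    odd-unique {i} {j} i<m j<m e = ℕ.*-cancelˡ-≡ i j 2 (ℕ.+-cancelʳ-≡ 1 (2 * i) (2 * j)
      (p-injective _ _ (ℕ.<⇒≤ (odd-< i<m)) (ℕ.<⇒≤ (odd-< j<m)) e))

    even-¬odd : ∀ {j} → j ≤ m → ¬ Odd (p (2 * j))
    even-¬odd {j} j≤m (i , i<m , e) = ℕ.even≢odd j i (sym (trans (ℕ.+-comm 1 (2 * i))
      (p-injective _ _ (ℕ.<⇒≤ (odd-< i<m)) (ℕ.*-monoʳ-≤ 2 j≤m) e)))

    next-¬odd : ∀ {j} → j < m → ¬ Odd (p (2 * j + 2))
    next-¬odd {j} j<m = subst (λ i → ¬ Odd (p i)) (sym (2*suc j)) (even-¬odd j<m)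

    neighbours-distinct : ∀ {j} → j < m → p (2 * j) ≢ p (2 * j + 2)
    neighbours-distinct {j} j<m e = ℕ.m≢1+n+m (2 * j) {1} (trans
      (p-injective _ _ (ℕ.*-monoʳ-≤ 2 (ℕ.<⇒≤ j<m))
        (subst (_≤ 2 * m) (sym (2*suc j)) (ℕ.*-monoʳ-≤ 2 j<m)) e)
      (ℕ.+-comm (2 * j) 2))

    -- The value away from the odd path vertices is junk.
    atOdd : (ℕ → ℕ) → Fin (V G) → Fin (V G)
    atOdd g u with odd? u
    ... | yes (j , _) = p (g j)
    ... | no _        = u

    atOdd-odd : ∀ g {j} → j < m → atOdd g (p (2 * j + 1)) ≡ p (g j)
    atOdd-odd g {j} j<m with odd? (p (2 * j + 1))
    ... | yes (i , i<m , e) = cong (p ∘ g) (odd-unique i<m j<m e)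
    ... | no ¬odd           = contradiction (j , j<m , refl) ¬odd

    -- At the first odd vertex `backward` stays put, as `ℕ.pred 0` is 0, and at the last one
    -- `forward` takes the value of `p` beyond the path. The conditions `prv e ≢ source` and
    -- `nxt e ≢ sink` exclude these two cases.
    before after backward forward : Fin (V G) → Fin (V G)
    before   = atOdd (λ j → 2 * j)
    after    = atOdd (λ j → 2 * j + 2)
    backward = atOdd (λ j → 2 * ℕ.pred j + 1)
    forward  = atOdd (λ j → 2 * suc j + 1)

    before-adj : ∀ {j} → j < m → Adj G (p (2 * j + 1)) (p (2 * j))
    before-adj {j} j<m = Adj-sym (subst (λ i → Adj G (p (2 * j)) (p i)) (ℕ.+-comm 1 (2 * j))
      (p-edge (2 * j) (ℕ.*-monoʳ-< 2 j<m)))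

    after-adj : ∀ {j} → j < m → Adj G (p (2 * j + 1)) (p (2 * j + 2))
    after-adj {j} j<m = subst (λ i → Adj G (p (2 * j + 1)) (p i)) (sym (after-odd j)) (p-edge _ (odd-< j<m))

    before-or-after : ∀ {j u} → j < m → Adj G u (p (2 * j + 1)) → u ≡ p (2 * j) ⊎ u ≡ p (2 * j + 2)
    before-or-after {j} j<m a = degree-two (p-degree j j<m) (before-adj j<m) (after-adj j<m) (Adj-sym a)
      (neighbours-distinct j<m)

    not-first : ∀ {j} → before (p (2 * j + 1)) ≢ p 0 → j < m → ∃ λ i → j ≡ suc i
    not-first {zero}  ne j<m = contradiction (atOdd-odd _ j<m) ne
    not-first {suc i} ne j<m = i , refl

    not-last : ∀ {j} → after (p (2 * j + 1)) ≢ p (2 * m) → j < m → suc j < m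
    not-last {j} ne j<m = ℕ.≤∧≢⇒< j<m λ { refl → ne (trans (atOdd-odd _ j<m) (cong p (2*suc j))) }

    pinnedPath : PinnedPath (Adj G) Adj-sym
    pinnedPath = record
      { source = p 0 ; sink = p (2 * m) ; Pin = Odd ; Pin? = odd?
      ; prv = before ; nxt = after ; pred = backward ; succ = forward
      ; source-unpinned = even-¬odd z≤n
      ; sink-unpinned = even-¬odd ℕ.≤-refl
      ; prv-unpinned = λ { (j , j<m , refl) → subst (¬_ ∘ Odd) (sym (atOdd-odd _ j<m)) (even-¬odd (ℕ.<⇒≤ j<m)) }
      ; nxt-unpinned = λ { (j , j<m , refl) → subst (¬_ ∘ Odd) (sym (atOdd-odd _ j<m)) (next-¬odd j<m) }
      ; prv-adj = λ { (j , j<m , refl) → subst (Adj G _) (sym (atOdd-odd _ j<m)) (before-adj j<m) }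
      ; nxt-adj = λ { (j , j<m , refl) → subst (Adj G _) (sym (atOdd-odd _ j<m)) (after-adj j<m) }
      ; only-prv = only-before
      ; only-nxt = only-after
      ; pred-pin = λ { (j , j<m , refl) ne → pred-pin j<m ne }
      ; succ-pin = λ { (j , j<m , refl) ne → suc j , not-last ne j<m , sym (atOdd-odd _ j<m) }
      ; nxt-pred = λ { (j , j<m , refl) ne → nxt-pred j<m ne }
      ; prv-succ = λ { (j , j<m , refl) ne → begin
          before (forward (p (2 * j + 1))) ≡⟨ cong before (atOdd-odd _ j<m) ⟩
          before (p (2 * suc j + 1))       ≡⟨ atOdd-odd _ (not-last ne j<m) ⟩
          p (2 * suc j)                    ≡⟨ cong p (2*suc j) ⟨
          p (2 * j + 2)                    ≡⟨ atOdd-odd _ j<m ⟨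
          after (p (2 * j + 1))            ∎ }
      ; succ-pred = λ { (j , j<m , refl) ne → succ-pred j<m ne }
      ; pred-succ = λ { (j , j<m , refl) ne → trans (cong backward (atOdd-odd _ j<m)) (atOdd-odd _ (not-last ne j<m)) }
      }
      where
      only-before : ∀ {e u} → Odd e → Adj G u e → u ≢ after e → u ≡ before e
      only-before (j , j<m , refl) a ne with before-or-after j<m a
      ... | inj₁ e = trans e (sym (atOdd-odd _ j<m))
      ... | inj₂ e = contradiction (trans e (sym (atOdd-odd _ j<m))) ne

      only-after : ∀ {e u} → Odd e → Adj G u e → u ≢ before e → u ≡ after e
      only-after (j , j<m , refl) a ne with before-or-after j<m a
      ... | inj₁ e = contradiction (trans e (sym (atOdd-odd _ j<m))) ne
      ... | inj₂ e = trans e (sym (atOdd-odd _ j<m))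

      pred-pin : ∀ {j} → j < m → before (p (2 * j + 1)) ≢ p 0 → Odd (backward (p (2 * j + 1)))
      pred-pin j<m ne with not-first ne j<m
      -- Here `j<m` reads `suc i < m`, and its weakening `suc i ≤ m` is `i < m`.
      ... | i , refl = i , ℕ.<⇒≤ j<m , sym (atOdd-odd _ j<m)

      nxt-pred : ∀ {j} → j < m → before (p (2 * j + 1)) ≢ p 0
               → after (backward (p (2 * j + 1))) ≡ before (p (2 * j + 1))
      nxt-pred j<m ne with not-first ne j<m
      ... | i , refl = begin
        after (backward (p (2 * suc i + 1))) ≡⟨ cong after (atOdd-odd _ j<m) ⟩
        after (p (2 * i + 1))                ≡⟨ atOdd-odd _ (ℕ.<⇒≤ j<m) ⟩
        p (2 * i + 2)                        ≡⟨ cong p (2*suc i) ⟩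
        p (2 * suc i)                        ≡⟨ atOdd-odd _ j<m ⟨
        before (p (2 * suc i + 1))           ∎

      succ-pred : ∀ {j} → j < m → before (p (2 * j + 1)) ≢ p 0
                → forward (backward (p (2 * j + 1))) ≡ p (2 * j + 1)
      succ-pred j<m ne with not-first ne j<m
      ... | i , refl = trans (cong forward (atOdd-odd _ j<m)) (atOdd-odd _ (ℕ.<⇒≤ j<m))

    Tree : PinnedPath (Adj G) Adj-sym → (Fin (V G) → Fin (V G)) → Set
    Tree = PinnedTree (Adj G) Adj-sym

    π π′ : PinnedPath (Adj G) Adj-sym
    π  = pinnedPath
    π′ = opposite (Adj G) Adj-sym π

    ForwardPins BackwardPins : (Fin (V G) → Fin (V G)) → Set
    ForwardPins  par = ∀ j → j < m → ContainsOriented G (p (2 * m)) par (p (2 * j + 1)) (p (2 * j + 2))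
    BackwardPins par = ∀ j → j < m → ContainsOriented G (p 0) par (p (2 * j + 1)) (p (2 * j))

    -- This supplies the condition in `ContainsOriented` that the tail of the edge is not the root.
    odd≢even : ∀ {i j} → i < m → j ≤ m → p (2 * i + 1) ≢ p (2 * j)
    odd≢even i<m j≤m e = even-¬odd j≤m (_ , i<m , e)

    forward⇒tree : ∀ {par} → IsRootedSpanningTree G (p (2 * m)) par × ForwardPins par → Tree π par
    forward⇒tree ((root , edges , reach) , pins) = record
      { root-fixed = root ; edges = edges ; rooted = reach
      ; pins = λ { (j , j<m , refl) → trans (proj₂ (pins j j<m)) (sym (atOdd-odd _ j<m)) } }

    tree⇒forward : ∀ {par} → Tree π par → IsRootedSpanningTree G (p (2 * m)) par × ForwardPins par
    tree⇒forward t = (root-fixed , edges , rooted) , λ j j<m →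
      odd≢even j<m ℕ.≤-refl , trans (pins (j , j<m , refl)) (atOdd-odd _ j<m)
      where open PinnedTree t

    backward⇒tree : ∀ {par} → IsRootedSpanningTree G (p 0) par × BackwardPins par → Tree π′ par
    backward⇒tree ((root , edges , reach) , pins) = record
      { root-fixed = root ; edges = edges ; rooted = reach
      ; pins = λ { (j , j<m , refl) → trans (proj₂ (pins j j<m)) (sym (atOdd-odd _ j<m)) } }

    tree⇒backward : ∀ {par} → Tree π′ par → IsRootedSpanningTree G (p 0) par × BackwardPins par
    tree⇒backward t = (root-fixed , edges , rooted) , λ j j<m →
      odd≢even j<m z≤n , trans (pins (j , j<m , refl)) (atOdd-odd _ j<m)
      where open PinnedTree t

    treeBijection : Bijection (TreeSetoid G (p (2 * m)) ForwardPins) (TreeSetoid G (p 0) BackwardPins)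
    treeBijection = record
      { to = λ (par , t) → let par′ , t′ , _ = corresponding (forward⇒tree t) in par′ , tree⇒backward t′
      ; cong = λ {s} {t} eq →
          let _ , s′ , c = corresponding (forward⇒tree (proj₂ s))
              _ , t′ , c′ = corresponding (forward⇒tree (proj₂ t))
          in corresponds-functional s′ t′ eq c c′
      ; bijective =
          (λ {s} {t} eq →
            let s₁ = forward⇒tree (proj₂ s)
                t₁ = forward⇒tree (proj₂ t)
            in corresponds-injective s₁ t₁ eq (proj₂ (proj₂ (corresponding s₁))) (proj₂ (proj₂ (corresponding t₁))))
        , λ (par′ , t′) →
            let par , t , c = corresponding⁻¹ (backward⇒tree t′)
            -- Surjectivity between setoids concerns every tree `z` pointwise equal to the preimage;
            -- the uniqueness of the matched tree covers them all.
            in (par , tree⇒forward t) , λ {z} eq →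
              let _ , z′ , c′ = corresponding (forward⇒tree (proj₂ z))
              in corresponds-functional z′ (backward⇒tree t′) eq c′ c
      }
      where open TreeBijection (Adj G) Adj-sym π

theorem2p3 : (G : PlaneGraph) (f : Fin (d G)) (m : ℕ) (p : ℕ → Fin (V G))
  → (∀ i j → i ≤ 2 * m → j ≤ 2 * m → p i ≡ p j → i ≡ j)
  → (∀ i → i < 2 * m → BoundaryEdge G f (p i) (p (suc i)))
  → (∀ j → j < m → degree G (p (2 * j + 1)) ≡ 2)
  → Bijection
      (TreeSetoid G (p (2 * m))
        (λ par → ∀ j → j < m → ContainsOriented G (p (2 * m)) par (p (2 * j + 1)) (p (2 * j + 2))))
      (TreeSetoid G (p 0)
        (λ par → ∀ j → j < m → ContainsOriented G (p 0) par (p (2 * j + 1)) (p (2 * j))))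
theorem2p3 G f m p p-injective p-boundary p-degree =
  treeBijection G m p p-injective (λ i i<2m → BoundaryEdge⇒Adj G (p-boundary i i<2m)) p-degree
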